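{- Let $H \in \mathbb{N}$ and $m_1, \ldots, m_H \in \mathbb{Z}$. Then there exist sets $A,B \subseteq \left[0,60H^2 \sum_{h=1}^H |m_h|\right]$, each of size at most $2+60H \sum_{h=1}^H |m_h|$, such that $$|hA|-|hB|=m_h$$ for each $1 \leq h \leq H$.
   Context: $\mathbb{N}$ denotes the positive integers. For integers $a \leq b$, $[a,b]:=\{a,a+1,\ldots,b\}$ denotes the integer interval, so $A,B$ are sets of integers. For a subset $A$ of an abelian group and $h \in \mathbb{N}$, the $h$-fold iterated sumset is $hA:=\{a_1+\cdots+a_h : a_1,\ldots,a_h \in A\}$ (repetitions allowed); here the group is $\mathbb{Z}$. $|X|$ denotes the cardinality of a finite set $X$, and $|m|$ the absolute value of an integer $m$. -}

module Defs where

import Algebra.Properties.Monoid.Sum as MonoidSum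
open import Data.Fin.Base using (Fin)
open import Data.Integer.Base using (ℤ; _≤_)
import Data.Integer.Properties as ℤ
import Data.List.Membership.Propositional as List
open import Data.List.Base using (length)
open import Data.List.Relation.Unary.Unique.Propositional using (Unique)
open import Data.Nat.Base using (ℕ)
import Data.Nat.Properties as ℕ
open import Data.Product.Base using (_×_; ∃-syntax)
open import Level using (0ℓ)
open import Relation.Binary.PropositionalEquality.Core using (_≡_)
open import Relation.Unary using (Pred; _∈_; _≐_)

SetOfℤ : Set₁
SetOfℤ = Pred ℤ 0ℓ

[_,_] : ℤ → ℤ → SetOfℤ
[ a , b ] x = a ≤ x × x ≤ b

sumℤ : ∀ {n} → (Fin n → ℤ) → ℤ
sumℤ = MonoidSum.sum ℤ.+-0-monoid

sumℕ : ∀ {n} → (Fin n → ℕ) → ℕ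
sumℕ = MonoidSum.sum ℕ.+-0-monoid

infix 8 _·_
_·_ : ℕ → SetOfℤ → SetOfℤ
(h · A) x = ∃[ a ] (∀ (i : Fin h) → a i ∈ A) × x ≡ sumℤ a

-- Cardinality is a relation rather than a function, since a predicate need
-- not be finite: X has cardinality n when some duplicate-free list of length n
-- has exactly the members of X.
infix 4 Card[_]≡_
Card[_]≡_ : SetOfℤ → ℕ → Set
Card[ X ]≡ n = ∃[ xs ] Unique xs × X ≐ (List._∈ xs) × length xs ≡ n

{-# OPTIONS --safe #-}
-- Given a list of gaps (possibly 0) with sum S ≤ P, where P > h, let T ⊆ [P, Q), Q = P + S, be the set
-- that starts at P and has these consecutive differences up to Q, and put
-- A = {0, 1} ∪ T ∪ [Q, 2Q].  A sum of h elements of A with no summand outside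
-- {0, 1} lies in [0, h], one with a single such summand t lies in [t, t + h)
-- or beyond Q, and one with two such summands is at least 2P ≥ Q.  Hence hA is
-- [0, h], the part of T + [0, h) below Q, and [Q, 2hQ]; the middle part has
-- Σ min(h, g) elements, summed over the gaps g.  Trading the gaps k, k for
-- k - 1, k + 1 preserves S and lowers this count by one exactly when h = k.
module Submission where

open import Defs
open import Agda.Builtin.Int using (pos)
open import Data.Empty using (⊥-elim)
open import Data.Fin.Base using (Fin; toℕ; zero; suc)
open import Data.Fin.Properties using (toℕ<n)
open import Data.Integer.Base as ℤ using (ℤ; +_; -[1+_]; _-_; ∣_∣; 0ℤ)
import Data.Integer.Properties as ℤ
open import Data.Integer.Tactic.RingSolver using () renaming (solve-∀ to ℤ-solve-∀)
import Algebra.Properties.CommutativeSemigroup ℤ.+-commutativeSemigroup as ℤ+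
open import Data.List.Base using (List; []; _∷_; _++_; map; length; applyUpTo)
open import Data.List.Membership.Propositional using (_∈_)
open import Data.List.Membership.Propositional.Properties
  using (∈-applyUpTo⁺; ∈-applyUpTo⁻; ∈-++⁺ˡ; ∈-++⁺ʳ; ∈-++⁻; ∈-map⁺; ∈-map⁻)
open import Data.List.Properties using (length-applyUpTo; length-++; length-map; map-++)
open import Data.List.Relation.Unary.All using ([])
open import Data.List.Relation.Unary.Any using (here)
open import Data.List.Relation.Unary.Unique.Propositional using (Unique; []; _∷_)
import Data.List.Relation.Unary.Unique.Propositional.Properties as Unique
import Data.Nat.Base as ℕ
open import Data.Nat.Base
  using (ℕ; zero; suc; NonZero; _+_; _*_; _^_; _∸_; _⊓_; _≤_; _<_; z≤n; s≤s; s≤s⁻¹;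
         >-nonZero; >-nonZero⁻¹)
open import Data.Nat.ListAction using (sum)
open import Data.Nat.ListAction.Properties using (sum-++)
open import Data.Nat.Properties
open import Data.Nat.Tactic.RingSolver using (solve-∀)
open import Data.Product.Base using (_×_; _,_; proj₁; proj₂; ∃-syntax)
open import Data.Sum.Base using (_⊎_; inj₁; inj₂)
import Data.Sum.Base as Sum
open import Function.Base using (_$_)
open import Relation.Binary.Definitions using (tri<; tri≈; tri>)
open import Relation.Binary.PropositionalEquality hiding ([_])
open import Relation.Nullary using (¬_; yes; no)
open import Relation.Unary using (_⊆_)

-- Windows of length `h` behind the points of `T`, below its end.

interval : ℕ → ℕ → List ℕ
interval a b = applyUpTo (a ℕ.+_) (b ∸ a)

∈-interval⁺ : ∀ {a b x} → a ≤ x → x < b → x ∈ interval a b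
∈-interval⁺ {a} {b} {x} a≤x x<b =
  subst (_∈ interval a b) (m+[n∸m]≡n a≤x) (∈-applyUpTo⁺ (a ℕ.+_) (∸-monoˡ-< x<b a≤x))

∈-interval⁻ : ∀ {a b x} → x ∈ interval a b → a ≤ x × x < b
∈-interval⁻ {a} {b} x∈ with i , i<b∸a , refl ← ∈-applyUpTo⁻ (a ℕ.+_) x∈ =
  m≤m+n a i , (begin-strict
    a + i       <⟨ +-monoʳ-< a i<b∸a ⟩
    a + (b ∸ a) ≡⟨ m+[n∸m]≡n {a} (<⇒≤ (m∸n≢0⇒n<m {b} {a} (λ eq → n≮0 (subst (i <_) eq i<b∸a)))) ⟩
    b           ∎)
  where open ≤-Reasoning

interval-unique : ∀ a b → Unique (interval a b)
interval-unique a b =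
  Unique.applyUpTo⁺₁ (a ℕ.+_) (b ∸ a) λ i<j _ eq → <⇒≢ i<j (+-cancelˡ-≡ a _ _ eq)

-- This lists the part of `T` + [0, h) below the last point of `T`, for `T` starting at `s`. Each
-- window is cut where the next point begins, so the pieces are disjoint and the cardinality is read
-- off as a sum of minima. The last point itself is left to the top interval.
fill : ℕ → ℕ → List ℕ → List ℕ
fill h s []       = []
fill h s (g ∷ gs) = interval s (s + (h ⊓ g)) ++ fill h (s + g) gs

truncatedSum : ℕ → List ℕ → ℕ
truncatedSum h gs = sum (map (h ⊓_) gs)

truncatedSum≤sum : ∀ h gs → truncatedSum h gs ≤ sum gs
truncatedSum≤sum h []       = z≤n
truncatedSum≤sum h (g ∷ gs) = +-mono-≤ (m⊓n≤n h g) (truncatedSum≤sum h gs)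

fill-lower : ∀ h s gs {x} → x ∈ fill h s gs → s ≤ x
fill-lower h s (g ∷ gs) x∈ with ∈-++⁻ (interval s _) x∈
... | inj₁ x∈ˡ = proj₁ (∈-interval⁻ x∈ˡ)
... | inj₂ x∈ʳ = ≤-trans (m≤m+n s g) (fill-lower h (s + g) gs x∈ʳ)

fill-upper : ∀ h s gs {x} → x ∈ fill h s gs → x < s + sum gs
fill-upper h s (g ∷ gs) {x} x∈ with ∈-++⁻ (interval s _) x∈
... | inj₁ x∈ˡ = <-≤-trans (proj₂ (∈-interval⁻ x∈ˡ))
                   (+-monoʳ-≤ s (≤-trans (m⊓n≤n h g) (m≤m+n g (sum gs))))
... | inj₂ x∈ʳ = subst (x <_) (+-assoc s g (sum gs)) (fill-upper h (s + g) gs x∈ʳ)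

fill-unique : ∀ h s gs → Unique (fill h s gs)
fill-unique h s []       = Unique.applyUpTo⁺₁ (s ℕ.+_) 0 λ _ ()
fill-unique h s (g ∷ gs) =
  Unique.++⁺ (interval-unique s _) (fill-unique h (s + g) gs) λ (x∈ˡ , x∈ʳ) →
    <⇒≱ (<-≤-trans (proj₂ (∈-interval⁻ x∈ˡ)) (+-monoʳ-≤ s (m⊓n≤n h g)))
        (fill-lower h (s + g) gs x∈ʳ)

fill-empty : ∀ s gs {x} → ¬ x ∈ fill 0 s gs
fill-empty s (g ∷ gs) x∈ with ∈-++⁻ (interval s _) x∈
... | inj₁ x∈ˡ = let s≤x , x<s = ∈-interval⁻ x∈ˡ in
                 <⇒≱ (subst (_ <_) (+-identityʳ s) x<s) s≤x
... | inj₂ x∈ʳ = fill-empty (s + g) gs x∈ʳ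

length-fill : ∀ h s gs → length (fill h s gs) ≡ truncatedSum h gs
length-fill h s []       = refl
length-fill h s (g ∷ gs) = trans (length-++ (interval s _)) (cong₂ _+_
  (trans (length-applyUpTo (s ℕ.+_) _) (m+n∸m≡n s _)) (length-fill h (s + g) gs))

-- What the cut removes from the window of `s` lies in the window of the next point, which starts no
-- earlier and so ends no earlier. Passing from point to point, `x` is caught by some piece or lies
-- past the end.
fill-first : ∀ h s gs {x} → s ≤ x → x < s + h → x ∈ fill h s gs ⊎ s + sum gs ≤ x
fill-first h s []       s≤x x<s+h = inj₂ (≤-trans (≤-reflexive (+-identityʳ s)) s≤x)
fill-first h s (g ∷ gs) {x} s≤x x<s+h with x <? s + g
... | yes x<s+g = inj₁ (∈-++⁺ˡ (∈-interval⁺ s≤x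
                    (subst (x <_) (sym (+-distribˡ-⊓ s h g)) (⊓-pres-m< x<s+h x<s+g))))
... | no  x≮s+g = Sum.map (∈-++⁺ʳ (interval s _)) (subst (_≤ x) (+-assoc s g (sum gs)))
                    (fill-first h (s + g) gs (≮⇒≥ x≮s+g)
                      (<-≤-trans x<s+h (+-monoˡ-≤ h (m≤m+n s g))))

-- If `x` is in the window of length `h` behind a point, then `x + j` is in the window of length
-- `h + k` behind the same point, where `fill-first` applies.
fill-extend : ∀ h k s gs {x j} → x ∈ fill h s gs → j ≤ k →
              x + j ∈ fill (h + k) s gs ⊎ s + sum gs ≤ x + j
fill-extend h k s (g ∷ gs) {x} {j} x∈ j≤k with ∈-++⁻ (interval s _) x∈
... | inj₁ x∈ˡ = let s≤x , x<end = ∈-interval⁻ x∈ˡ in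
                 fill-first (h + k) s (g ∷ gs) (m≤n⇒m≤n+o j s≤x)
                   (subst (x + j <_) (+-assoc s h k)
                     (+-mono-<-≤ (<-≤-trans x<end (+-monoʳ-≤ s (m⊓n≤m h g))) j≤k))
... | inj₂ x∈ʳ = Sum.map (∈-++⁺ʳ (interval s _)) (subst (_≤ x + j) (+-assoc s g (sum gs)))
                   (fill-extend h k (s + g) gs x∈ʳ j≤k)

-- The witness `t` is the point whose piece contains `z`, and `j` is the offset in that piece, at
-- most `h` because the window has length `suc h`.
fill-split : ∀ h s gs {z} → z ∈ fill (suc h) s gs →
             ∃[ t ] ∃[ j ] t ∈ fill 1 s gs × j ≤ h × z ≡ t + j
-- A gap 0 gives an empty piece, also in `fill 1`. So `s` can serve as `t` only in front of a
-- positive gap.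
fill-split h s (zero ∷ gs) z∈ with ∈-++⁻ (interval s _) z∈
... | inj₁ z∈ˡ = let s≤z , z<s = ∈-interval⁻ z∈ˡ in
                 ⊥-elim (<⇒≱ (subst (_ <_) (+-identityʳ s) z<s) s≤z)
... | inj₂ z∈ʳ = let t , j , t∈ , rest = fill-split h (s + 0) gs z∈ʳ in
                 t , j , ∈-++⁺ʳ (interval s _) t∈ , rest
fill-split h s (suc g ∷ gs) {z} z∈ with ∈-++⁻ (interval s _) z∈
... | inj₁ z∈ˡ =
  let s≤z , z<end = ∈-interval⁻ z∈ˡ
      z≡s+j = sym (m+[n∸m]≡n s≤z)
      j<h⊓g = +-cancelˡ-< s (z ∸ s) _ (subst (_< _) z≡s+j z<end)
  in s , z ∸ s , ∈-++⁺ˡ (∈-interval⁺ ≤-refl (m<m+n s (s≤s z≤n)))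
   , ≤-trans (s≤s⁻¹ j<h⊓g) (m⊓n≤m h g) , z≡s+j
... | inj₂ z∈ʳ = let t , j , t∈ , rest = fill-split h (s + suc g) gs z∈ʳ in
                 t , j , ∈-++⁺ʳ (interval s _) t∈ , rest

layer : ℕ → List ℕ → ℕ → List ℕ
layer P gs h = interval 0 (suc h) ++ fill h P gs ++ interval Q (suc (h * (Q + Q)))
  where Q = P + sum gs

length-layer : ∀ P gs h → let Q = P + sum gs in
  length (layer P gs h) ≡ suc h + (truncatedSum h gs + (suc (h * (Q + Q)) ∸ Q))
length-layer P gs h =
  trans (length-++ (interval 0 (suc h))) (cong₂ _+_ (length-applyUpTo (0 ℕ.+_) (suc h))
    (trans (length-++ (fill h P gs)) (cong₂ _+_ (length-fill h P gs) (length-applyUpTo _ _))))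

-- From a recursion between lists to iterated sumsets in the integers.

-- The fields say that `L 0` is {0} and that `L (suc h)` is the sumset of `L 1` and `L h`. By
-- induction this forces `L h` to be the `h`-fold sumset of `L 1`, so only one addition at a time
-- has to be examined.
record SumsetSequence (L : ℕ → List ℕ) : Set where
  field
    zero∈   : 0 ∈ L 0
    ∈⇒zero  : ∀ {x} → x ∈ L 0 → x ≡ 0
    add     : ∀ h {x y} → x ∈ L 1 → y ∈ L h → x + y ∈ L (suc h)
    split   : ∀ h {z} → z ∈ L (suc h) → ∃[ x ] ∃[ y ] x ∈ L 1 × y ∈ L h × z ≡ x + y

module _ {L : ℕ → List ℕ} (seq : SumsetSequence L) where
  open SumsetSequence seq

  sumset⊆ : ∀ h → (h · (_∈ map pos (L 1))) ⊆ (_∈ map pos (L h))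
  sumset⊆ zero    (a , a∈ , refl) = ∈-map⁺ pos zero∈
  sumset⊆ (suc h) (a , a∈ , refl)
    with x , x∈ , a₀≡x ← ∈-map⁻ pos (a∈ zero)
    with y , y∈ , s≡y  ← ∈-map⁻ pos (sumset⊆ h ((λ i → a (suc i)) , (λ i → a∈ (suc i)) , refl))
    = subst (_∈ map pos (L (suc h))) (sym (cong₂ ℤ._+_ a₀≡x s≡y)) (∈-map⁺ pos (add h x∈ y∈))

  sumset⊇ : ∀ h → (_∈ map pos (L h)) ⊆ (h · (_∈ map pos (L 1)))
  sumset⊇ zero    z∈ with z , z∈ , refl ← ∈-map⁻ pos z∈ = (λ ()) , (λ ()) , cong pos (∈⇒zero z∈)
  sumset⊇ (suc h) z∈
    with z , z∈ , refl         ← ∈-map⁻ pos z∈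
    with x , y , x∈ , y∈ , refl ← split h z∈
    with a , a∈ , y≡           ← sumset⊇ h (∈-map⁺ pos y∈)
    = (λ { zero → + x ; (suc i) → a i })
    , (λ { zero → ∈-map⁺ pos x∈ ; (suc i) → a∈ i })
    , cong (ℤ._+_ (+ x)) y≡

  card-sumset : ∀ h → Unique (L h) → Card[ h · (_∈ map pos (L 1)) ]≡ length (L h)
  card-sumset h uniq =
    map pos (L h) , Unique.map⁺ ℤ.+-injective uniq , (sumset⊆ h , sumset⊇ h) , length-map pos (L h)

card-map-+ : ∀ {xs} → Unique xs → Card[ (_∈ map pos xs) ]≡ length xs
card-map-+ {xs} uniq =
  map pos xs , Unique.map⁺ ℤ.+-injective uniq , ((λ x∈ → x∈) , (λ x∈ → x∈)) , length-map pos xs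

-- The layers form a sumset sequence; their range and size.

module Layer (P : ℕ) (gs : List ℕ) (0<P : 0 < P) (sum≤P : sum gs ≤ P) where

  Q N : ℕ
  Q = P + sum gs
  N = Q + Q

  Q≤2P : Q ≤ P + P
  Q≤2P = +-monoʳ-≤ P sum≤P

  0<Q : 0 < Q
  0<Q = m≤n⇒m≤n+o (sum gs) 0<P

  Q≤N : Q ≤ N
  Q≤N = m≤m+n Q Q

  -- The three regions of a layer. They may overlap for large `h`; disjointness enters only in
  -- `unique`.
  data Position (h x : ℕ) : Set where
    low  : x ≤ h → Position h x
    mid  : x ∈ fill h P gs → Position h x
    high : Q ≤ x → x ≤ h * N → Position h x

  position : ∀ h {x} → x ∈ layer P gs h → Position h x
  position h x∈ with ∈-++⁻ (interval 0 (suc h)) x∈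
  ... | inj₁ x∈ˡ = low (s≤s⁻¹ (proj₂ (∈-interval⁻ {0} {suc h} x∈ˡ)))
  ... | inj₂ x∈ʳ with ∈-++⁻ (fill h P gs) x∈ʳ
  ...   | inj₁ x∈ᵐ = mid x∈ᵐ
  ...   | inj₂ x∈ʰ = let Q≤x , x<end = ∈-interval⁻ x∈ʰ in high Q≤x (s≤s⁻¹ x<end)

  member : ∀ h {x} → Position h x → x ∈ layer P gs h
  member h (low x≤h)    = ∈-++⁺ˡ (∈-interval⁺ z≤n (s≤s x≤h))
  member h (mid x∈)     = ∈-++⁺ʳ (interval 0 (suc h)) (∈-++⁺ˡ x∈)
  member h (high Q≤x x≤) =
    ∈-++⁺ʳ (interval 0 (suc h)) (∈-++⁺ʳ (fill h P gs) (∈-interval⁺ Q≤x (s≤s x≤)))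

  bounded : ∀ h {x} → Position h x → x ≤ h * N
  bounded h (low x≤h)     = ≤-trans x≤h (m≤m*n h N {{>-nonZero (≤-trans 0<Q Q≤N)}})
  -- At `h` = 0 the bound is 0, so the middle region has to be empty.
  bounded zero    (mid x∈) = ⊥-elim (fill-empty P gs x∈)
  bounded (suc h) (mid x∈) =
    ≤-trans (<⇒≤ (fill-upper (suc h) P gs x∈)) (m≤n⇒m≤n+o (h * N) Q≤N)
  bounded h (high _ x≤)   = x≤

  add-position : ∀ h {x y} → Position 1 x → Position h y → Position (suc h) (x + y)
  add-position h {x} {y} px py = go px py
    where
    x+y≤ : x + y ≤ suc h * N
    x+y≤ = +-mono-≤ (≤-trans (bounded 1 px) (≤-reflexive (*-identityˡ N))) (bounded h py)

    from : ∀ {z} → z ∈ fill (suc h) P gs ⊎ Q ≤ z → z ≡ x + y → Position (suc h) (x + y)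
    from (inj₁ z∈) refl = mid z∈
    from (inj₂ Q≤z) refl = high Q≤z x+y≤

    go : Position 1 x → Position h y → Position (suc h) (x + y)
    go (low x≤1)  (low y≤h)  = low (+-mono-≤ x≤1 y≤h)
    go (low x≤1)  (mid y∈)   =
      from (subst (λ k → y + x ∈ fill k P gs ⊎ Q ≤ y + x) (+-comm h 1)
             (fill-extend h 1 P gs y∈ x≤1)) (+-comm y x)
    go (mid x∈)   (low y≤h)  = from (fill-extend 1 h P gs x∈ y≤h) refl
    go (mid x∈)   (mid y∈)   =
      high (≤-trans Q≤2P (+-mono-≤ (fill-lower 1 P gs x∈) (fill-lower h P gs y∈))) x+y≤
    go (high Q≤x _) _        = high (m≤n⇒m≤n+o y Q≤x) x+y≤
    go _        (high Q≤y _) = high (m≤n⇒m≤o+n x Q≤y) x+y≤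

  high₁ : ∀ {x} → Q ≤ x → x ≤ N → Position 1 x
  high₁ Q≤x x≤N = high Q≤x (≤-trans x≤N (≤-reflexive (sym (*-identityˡ N))))

  split-position : ∀ h {z} → Position (suc h) z →
                   ∃[ x ] ∃[ y ] Position 1 x × Position h y × z ≡ x + y
  split-position h {zero}  (low _)   = 0 , 0 , low z≤n , low z≤n , refl
  split-position h {suc z} (low z<h) = 1 , z , low ≤-refl , low (s≤s⁻¹ z<h) , refl
  split-position h (mid z∈) = let t , j , t∈ , j≤h , z≡ = fill-split h P gs z∈ in
                              t , j , mid t∈ , low j≤h , z≡
  split-position h {z} (high Q≤z z≤) with z ≤? N
  ... | yes z≤N = z , 0 , high₁ Q≤z z≤N , low z≤n , sym (+-identityʳ z)
  split-position zero {z} (high Q≤z z≤) | no z≰N =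
    ⊥-elim (z≰N (≤-trans z≤ (≤-reflexive (*-identityˡ N))))
  split-position (suc h) {z} (high Q≤z z≤) | no z≰N with N + Q ≤? z
  -- Taking off the largest element `N` leaves at least `Q`, so the rest stays in the top region.
  ... | yes N+Q≤z =
    N , z ∸ N , high₁ Q≤N ≤-refl
    , high (m+n≤o⇒m≤o∸n Q (≤-trans (≤-reflexive (+-comm Q N)) N+Q≤z)) (m≤n+o⇒m∸n≤o z N z≤)
    , sym (m+[n∸m]≡n (≰⇒≥ z≰N))
  -- Now `z` lies between `N` and `N + Q`, and taking off `N` would leave less than `Q`. Leaving
  -- exactly `Q` works instead: since `N` is twice `Q`, the summand `z ∸ Q` lies between `Q` and
  -- `N`.
  ... | no  N+Q≰z =
    z ∸ Q , Q
    , high₁ (m+n≤o⇒m≤o∸n Q (≰⇒≥ z≰N))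
            (m≤n+o⇒m∸n≤o z Q (≤-trans (≰⇒≥ N+Q≰z) (≤-reflexive (+-comm N Q))))
    , high ≤-refl (m≤n⇒m≤n+o (h * N) Q≤N)
    , sym (m∸n+n≡m Q≤z)

  sumsetSequence : SumsetSequence (layer P gs)
  sumsetSequence = record
    { zero∈  = member 0 (low z≤n)
    ; ∈⇒zero = λ x∈ → n≤0⇒n≡0 (bounded 0 (position 0 x∈))
    ; add    = λ h x∈ y∈ → member (suc h) (add-position h (position 1 x∈) (position h y∈))
    ; split  = λ h z∈ → let x , y , px , py , z≡ = split-position h (position (suc h) z∈) in
                        x , y , member 1 px , member h py , z≡
    }

  -- The bound on `h` keeps [0, h] below `P`, where the other regions begin at the earliest; the
  -- middle region ends before `Q`.
  unique : ∀ h → h < P → Unique (layer P gs h)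
  unique h h<P =
    Unique.++⁺ (interval-unique 0 (suc h))
      (Unique.++⁺ (fill-unique h P gs) (interval-unique Q _) λ (x∈ᵐ , x∈ʰ) →
        <⇒≱ (fill-upper h P gs x∈ᵐ) (proj₁ (∈-interval⁻ x∈ʰ)))
      λ (x∈ˡ , x∈ʳ) → <⇒≱ (<-≤-trans (proj₂ (∈-interval⁻ {0} {suc h} x∈ˡ)) h<P) (above (∈-++⁻ (fill h P gs) x∈ʳ))
    where
    above : ∀ {x} → x ∈ fill h P gs ⊎ x ∈ interval Q (suc (h * N)) → P ≤ x
    above (inj₁ x∈) = fill-lower h P gs x∈
    above (inj₂ x∈) = ≤-trans (m≤m+n P (sum gs)) (proj₁ (∈-interval⁻ x∈))

  N≤4P : N ≤ 4 * P
  N≤4P = begin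
    Q + Q             ≤⟨ +-mono-≤ Q≤2P Q≤2P ⟩
    P + P + (P + P)   ≡⟨ regroup P ⟩
    4 * P             ∎
    where
    open ≤-Reasoning
    regroup : ∀ p → p + p + (p + p) ≡ 4 * p
    regroup = solve-∀

  layer₁-within : (_∈ map pos (layer P gs 1)) ⊆ [ 0ℤ , + (4 * P) ]
  layer₁-within x∈ with n , n∈ , refl ← ∈-map⁻ pos x∈ =
    ℤ.+≤+ z≤n
    , ℤ.+≤+ (≤-trans (bounded 1 (position 1 n∈)) (≤-trans (≤-reflexive (*-identityˡ N)) N≤4P))

  length-layer₁ : length (layer P gs 1) ≤ 2 + 4 * P
  length-layer₁ = begin
    length (layer P gs 1)                             ≡⟨ length-layer P gs 1 ⟩
    2 + (truncatedSum 1 gs + (suc (1 * N) ∸ Q))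
      ≤⟨ +-monoʳ-≤ 2 (+-mono-≤ (≤-trans (truncatedSum≤sum 1 gs) sum≤P) (m≤n+o⇒m∸n≤o _ Q (regroup Q))) ⟩
    -- The extra 1 in `suc Q` is paid for by one more `P`, as `P` is positive.
    2 + (P + suc Q)                                   ≤⟨ +-monoʳ-≤ 2 (+-monoʳ-≤ P (+-mono-≤ 0<P Q≤2P)) ⟩
    2 + (P + (P + (P + P)))                           ≡⟨ regroup′ P ⟩
    2 + 4 * P                                         ∎
    where
    open ≤-Reasoning
    regroup : ∀ q → suc (1 * (q + q)) ≤ q + suc q
    regroup q = ≤-reflexive (trans (cong suc (*-identityˡ (q + q))) (sym (+-suc q q)))
    regroup′ : ∀ p → 2 + (p + (p + (p + p))) ≡ 2 + 4 * p
    regroup′ = solve-∀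

-- Trading gaps with a fixed sum.

-- The index is shifted so that the trade is felt at `h` = `suc k`. For `k` = 0 it replaces 1, 1 by
-- 0, 2, where the gap 0 merely repeats a point.
level spread : ℕ → ℕ → List ℕ
level k zero     = []
level k (suc n)  = suc k ∷ suc k ∷ level k n
spread k zero    = []
spread k (suc n) = k ∷ suc (suc k) ∷ spread k n

-- As a function of the gap, the minimum with `h` is linear on either side of `h`. Its second
-- difference at `suc k` therefore vanishes unless the kink is there, in which case it is -1, as
-- `⊓-concave-at` records.
⊓-concave-off : ∀ h k → h ≢ suc k → h ⊓ suc k + h ⊓ suc k ≡ h ⊓ k + h ⊓ suc (suc k)
⊓-concave-off h k h≢ with <-cmp h (suc k)
... | tri≈ _ h≡ _ = ⊥-elim (h≢ h≡)
... | tri< h<1+k _ _ = cong₂ _+_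
  (trans (m≤n⇒m⊓n≡m (<⇒≤ h<1+k)) (sym (m≤n⇒m⊓n≡m (s≤s⁻¹ h<1+k))))
  (trans (m≤n⇒m⊓n≡m (<⇒≤ h<1+k)) (sym (m≤n⇒m⊓n≡m (m≤n⇒m≤1+n (<⇒≤ h<1+k)))))
... | tri> _ _ k+1<h = begin
  h ⊓ suc k + h ⊓ suc k   ≡⟨ cong₂ _+_ 1+k 1+k ⟩
  suc k + suc k           ≡⟨ +-suc k (suc k) ⟨
  k + suc (suc k)         ≡⟨ cong₂ _+_ (m≥n⇒m⊓n≡n (≤-trans (n≤1+n k) (<⇒≤ k+1<h)))
                                       (m≥n⇒m⊓n≡n k+1<h) ⟨
  h ⊓ k + h ⊓ suc (suc k) ∎
  where
  open ≡-Reasoning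
  1+k = m≥n⇒m⊓n≡n (<⇒≤ k+1<h)

⊓-concave-at : ∀ k → suc k ⊓ suc k + suc k ⊓ suc k ≡ suc (suc k ⊓ k + suc k ⊓ suc (suc k))
⊓-concave-at k = cong₂ _+_
  (trans (⊓-idem (suc k)) (cong suc (sym (m≥n⇒m⊓n≡n (n≤1+n k)))))
  (trans (⊓-idem (suc k)) (sym (m≤n⇒m⊓n≡m (n≤1+n (suc k)))))

truncatedSum-off : ∀ h k n → h ≢ suc k →
                   truncatedSum h (level k n) ≡ truncatedSum h (spread k n)
truncatedSum-off h k zero    h≢ = refl
truncatedSum-off h k (suc n) h≢ = begin
  h ⊓ suc k + (h ⊓ suc k + truncatedSum h (level k n))    ≡⟨ +-assoc (h ⊓ suc k) _ _ ⟨
  h ⊓ suc k + h ⊓ suc k + truncatedSum h (level k n)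
    ≡⟨ cong₂ _+_ (⊓-concave-off h k h≢) (truncatedSum-off h k n h≢) ⟩
  h ⊓ k + h ⊓ suc (suc k) + truncatedSum h (spread k n)   ≡⟨ +-assoc (h ⊓ k) _ _ ⟩
  h ⊓ k + (h ⊓ suc (suc k) + truncatedSum h (spread k n)) ∎
  where open ≡-Reasoning

truncatedSum-at : ∀ k n → truncatedSum (suc k) (level k n) ≡ n + truncatedSum (suc k) (spread k n)
truncatedSum-at k zero    = refl
truncatedSum-at k (suc n) = begin
  h ⊓ h + (h ⊓ h + truncatedSum h (level k n)) ≡⟨ +-assoc (h ⊓ h) _ _ ⟨
  h ⊓ h + h ⊓ h + truncatedSum h (level k n)   ≡⟨ cong₂ _+_ (⊓-concave-at k) (truncatedSum-at k n) ⟩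
  suc (h ⊓ k + h ⊓ suc h) + (n + truncatedSum h (spread k n))
    ≡⟨ regroup (h ⊓ k) (h ⊓ suc h) n (truncatedSum h (spread k n)) ⟩
  suc n + (h ⊓ k + (h ⊓ suc h + truncatedSum h (spread k n))) ∎
  where
  open ≡-Reasoning
  h = suc k
  regroup : ∀ a b c d → suc (a + b) + (c + d) ≡ suc c + (a + (b + d))
  regroup = solve-∀

sum-level : ∀ k n → sum (level k n) ≡ 2 * (suc k * n)
sum-level k zero    = cong (2 *_) (sym (*-zeroʳ (suc k)))
sum-level k (suc n) = trans (cong (λ s → suc k + (suc k + s)) (sum-level k n)) (regroup (suc k) n)
  where
  regroup : ∀ a n → a + (a + 2 * (a * n)) ≡ 2 * (a * suc n)
  regroup = solve-∀

sum-spread : ∀ k n → sum (spread k n) ≡ 2 * (suc k * n)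
sum-spread k zero    = cong (2 *_) (sym (*-zeroʳ (suc k)))
sum-spread k (suc n) = trans (cong (λ s → k + (suc (suc k) + s)) (sum-spread k n)) (regroup k n)
  where
  regroup : ∀ k n → k + (suc (suc k) + 2 * (suc k * n)) ≡ 2 * (suc k * suc n)
  regroup = solve-∀

-- `upper` will serve `A` and `lower` will serve `B`. A negative `z` swaps the roles of the two
-- lists, with its absolute value as the number of trades.
upper lower : ℕ → ℤ → List ℕ
upper k (+ n)    = level k n
upper k -[1+ n ] = spread k (suc n)
lower k (+ n)    = spread k n
lower k -[1+ n ] = level k (suc n)

sum-upper : ∀ k z → sum (upper k z) ≡ 2 * (suc k * ∣ z ∣)
sum-upper k (+ n)    = sum-level k n
sum-upper k -[1+ n ] = sum-spread k (suc n)

sum-lower : ∀ k z → sum (lower k z) ≡ 2 * (suc k * ∣ z ∣)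
sum-lower k (+ n)    = sum-spread k n
sum-lower k -[1+ n ] = sum-level k (suc n)

-- The difference of the two counts, stated without subtraction so that excesses add under
-- concatenation.
record Excess (h : ℕ) (gs gs′ : List ℕ) (z : ℤ) : Set where
  constructor excess
  field difference : + truncatedSum h gs ≡ z ℤ.+ + truncatedSum h gs′

truncatedSum-++ : ∀ h gs gs′ → truncatedSum h (gs ++ gs′) ≡ truncatedSum h gs + truncatedSum h gs′
truncatedSum-++ h gs gs′ = trans (cong sum (map-++ (h ⊓_) gs gs′)) (sum-++ (map (h ⊓_) gs) _)

excess-++ : ∀ {h as as′ bs bs′ y z} → Excess h as as′ y → Excess h bs bs′ z →
            Excess h (as ++ bs) (as′ ++ bs′) (y ℤ.+ z)
excess-++ {h} {as} {as′} {bs} {bs′} {y} {z} (excess eqᵃ) (excess eqᵇ) = excess (begin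
  + truncatedSum h (as ++ bs)                           ≡⟨ cong pos (truncatedSum-++ h as bs) ⟩
  + truncatedSum h as ℤ.+ + truncatedSum h bs           ≡⟨ cong₂ ℤ._+_ eqᵃ eqᵇ ⟩
  (y ℤ.+ + truncatedSum h as′) ℤ.+ (z ℤ.+ + truncatedSum h bs′)
    ≡⟨ ℤ+.interchange y (+ truncatedSum h as′) z (+ truncatedSum h bs′) ⟩
  (y ℤ.+ z) ℤ.+ (+ truncatedSum h as′ ℤ.+ + truncatedSum h bs′)
    ≡⟨ cong (λ s → (y ℤ.+ z) ℤ.+ + s) (truncatedSum-++ h as′ bs′) ⟨
  (y ℤ.+ z) ℤ.+ + truncatedSum h (as′ ++ bs′)           ∎)
  where open ≡-Reasoning

excess-off : ∀ h k z → h ≢ suc k → Excess h (upper k z) (lower k z) 0ℤ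
excess-off h k (+ n)    h≢ = excess $ cong pos (truncatedSum-off h k n h≢)
excess-off h k -[1+ n ] h≢ = excess $ cong pos (sym (truncatedSum-off h k (suc n) h≢))

excess-at : ∀ k z → Excess (suc k) (upper k z) (lower k z) z
excess-at k (+ n)    = excess $ cong pos (truncatedSum-at k n)
excess-at k -[1+ n ] = excess (begin
  + s                                        ≡⟨ ℤ.+-identityˡ (+ s) ⟨
  0ℤ ℤ.+ + s                                 ≡⟨ cong (ℤ._+ + s) (ℤ.+-inverseˡ (+ suc n)) ⟨
  (-[1+ n ] ℤ.+ + suc n) ℤ.+ + s             ≡⟨ ℤ.+-assoc -[1+ n ] (+ suc n) (+ s) ⟩
  -[1+ n ] ℤ.+ + (suc n + s)                 ≡⟨ cong (λ t → -[1+ n ] ℤ.+ + t) (truncatedSum-at k (suc n)) ⟨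
  -[1+ n ] ℤ.+ + truncatedSum (suc k) (level k (suc n)) ∎)
  where
  open ≡-Reasoning
  s = truncatedSum (suc k) (spread k (suc n))

-- One block of trades for each prescribed difference.

uppers lowers : ∀ {n} → ℕ → (Fin n → ℤ) → List ℕ
uppers {zero}  k m = []
uppers {suc n} k m = upper k (m zero) ++ uppers (suc k) (λ i → m (suc i))
lowers {zero}  k m = []
lowers {suc n} k m = lower k (m zero) ++ lowers (suc k) (λ i → m (suc i))

-- Every block here is aimed at a value above `k`, hence above `h`, and so contributes nothing.
excess-below : ∀ {n} h k (m : Fin n → ℤ) → h ≤ k → Excess h (uppers k m) (lowers k m) 0ℤ
excess-below {zero}  h k m h≤k = excess refl
excess-below {suc n} h k m h≤k =
  excess-++ (excess-off h k (m zero) (<⇒≢ (s≤s h≤k)))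
            (excess-below h (suc k) (λ i → m (suc i)) (m≤n⇒m≤1+n h≤k))

-- Only the block of index `i` is aimed at this value. Earlier blocks are off target one by one, and
-- later ones are covered by `excess-below`.
excess-prescribed : ∀ {n} k (m : Fin n → ℤ) i → Excess (suc (k + toℕ i)) (uppers k m) (lowers k m) (m i)
excess-prescribed {suc n} k m zero rewrite +-identityʳ k =
  subst (Excess (suc k) (uppers k m) (lowers k m)) (ℤ.+-identityʳ (m zero))
    (excess-++ (excess-at k (m zero))
      (excess-below (suc k) (suc k) (λ i → m (suc i)) ≤-refl))
excess-prescribed {suc n} k m (suc i) rewrite +-suc k (toℕ i) =
  subst (Excess h (uppers k m) (lowers k m)) (ℤ.+-identityˡ (m (suc i)))
    (excess-++ (excess-off h k (m zero) (>⇒≢ (s≤s (s≤s (m≤m+n k (toℕ i))))))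
      (excess-prescribed (suc k) (λ i → m (suc i)) i))
  where h = suc (suc (k + toℕ i))

-- Equal totals give both sets the same `Q`, hence the same top interval in every layer.
sum-uppers≡sum-lowers : ∀ {n} k (m : Fin n → ℤ) → sum (uppers k m) ≡ sum (lowers k m)
sum-uppers≡sum-lowers {zero}  k m = refl
sum-uppers≡sum-lowers {suc n} k m = begin
  sum (upper k (m zero) ++ uppers (suc k) m′)      ≡⟨ sum-++ (upper k (m zero)) _ ⟩
  sum (upper k (m zero)) + sum (uppers (suc k) m′)
    ≡⟨ cong₂ _+_ (trans (sum-upper k (m zero)) (sym (sum-lower k (m zero))))
                 (sum-uppers≡sum-lowers (suc k) m′) ⟩
  sum (lower k (m zero)) + sum (lowers (suc k) m′) ≡⟨ sum-++ (lower k (m zero)) _ ⟨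
  sum (lower k (m zero) ++ lowers (suc k) m′)      ∎
  where
  open ≡-Reasoning
  m′ = λ i → m (suc i)

-- A block aimed at a value `j` has sum 2 `j` times the absolute value of its entry of `m`, and
-- every `j` is at most `k + n`.
sum-uppers≤ : ∀ {n} k (m : Fin n → ℤ) → sum (uppers k m) ≤ 2 * ((k + n) * sumℕ (λ i → ∣ m i ∣))
sum-uppers≤ {zero}  k m = z≤n
sum-uppers≤ {suc n} k m = begin
  sum (upper k (m zero) ++ uppers (suc k) m′)      ≡⟨ sum-++ (upper k (m zero)) _ ⟩
  sum (upper k (m zero)) + sum (uppers (suc k) m′)
    ≤⟨ +-mono-≤ (≤-reflexive (sum-upper k (m zero))) (sum-uppers≤ (suc k) m′) ⟩
  2 * (suc k * a) + 2 * ((suc k + n) * s)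
    ≤⟨ +-monoˡ-≤ _ (*-monoʳ-≤ 2 (*-monoˡ-≤ a (m≤m+n (suc k) n))) ⟩
  2 * ((suc k + n) * a) + 2 * ((suc k + n) * s)    ≡⟨ regroup k n a s ⟩
  2 * ((k + suc n) * (a + s))                      ∎
  where
  open ≤-Reasoning
  m′ = λ i → m (suc i)
  a = ∣ m zero ∣
  s = sumℕ (λ i → ∣ m′ i ∣)
  regroup : ∀ k n a s → 2 * ((suc k + n) * a) + 2 * ((suc k + n) * s) ≡ 2 * ((k + suc n) * (a + s))
  regroup = solve-∀

∣m∣≤sum : ∀ {n} (m : Fin n → ℤ) i → ∣ m i ∣ ≤ sumℕ (λ j → ∣ m j ∣)
∣m∣≤sum m zero    = m≤m+n ∣ m zero ∣ _
∣m∣≤sum m (suc i) = m≤n⇒m≤o+n ∣ m zero ∣ (∣m∣≤sum (λ j → m (suc j)) i)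

-- Assembling the two sets.

-- This covers total 0, where the general choice of `P` would be 0. All differences are then 0, and
-- {0} can be taken for both sets.
singleton : SumsetSequence (λ _ → 0 ∷ [])
singleton = record
  { zero∈  = here refl
  ; ∈⇒zero = λ { (here eq) → eq }
  ; add    = λ { _ (here refl) (here refl) → here refl }
  ; split  = λ { _ (here refl) → 0 , 0 , here refl , here refl , refl }
  }

-- The total is a separate parameter `M` so that the proof can split on whether it vanishes.
Realizable : (H : ℕ) → (Fin H → ℤ) → ℕ → Set₁
Realizable H m M =
  ∃[ A ] ∃[ B ]
  A ⊆ [ 0ℤ , + (60 * H ^ 2 * M) ] ×
  B ⊆ [ 0ℤ , + (60 * H ^ 2 * M) ] ×
  (∃[ k ] Card[ A ]≡ k × k ≤ 2 + 60 * H * M) ×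
  (∃[ k ] Card[ B ]≡ k × k ≤ 2 + 60 * H * M) ×
  (∀ (i : Fin H) → let h = suc (toℕ i) in
  ∃[ p ] ∃[ q ] Card[ h · A ]≡ p × Card[ h · B ]≡ q × + p - + q ≡ m i)

realizable-zero : ∀ {H} (m : Fin H → ℤ) → (∀ i → m i ≡ 0ℤ) → Realizable H m 0
realizable-zero m m≡0 =
  (_∈ map pos (0 ∷ [])) , (_∈ map pos (0 ∷ [])) , bound , bound , card , card
  , λ i → let c = card-sumset singleton (suc (toℕ i)) ([] ∷ []) in
          1 , 1 , c , c , sym (m≡0 i)
  where
  bound : ∀ {r} → (_∈ map pos (0 ∷ [])) ⊆ [ 0ℤ , + r ]
  bound (here refl) = ℤ.+≤+ z≤n , ℤ.+≤+ z≤n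
  card : ∀ {r} → ∃[ k ] Card[ (_∈ map pos (0 ∷ [])) ]≡ k × k ≤ 2 + r
  card = 1 , card-map-+ ([] ∷ []) , s≤s z≤n

-- The bottom intervals agree, and equal sums make the top ones agree; what remains is the
-- difference of the truncated sums.
Excess⇒length-difference : ∀ P gs gs′ h {z} → sum gs ≡ sum gs′ → Excess h gs gs′ z →
                           + length (layer P gs h) - + length (layer P gs′ h) ≡ z
Excess⇒length-difference P gs gs′ h {z} sum≡ (excess eq) = begin
  + length (layer P gs h) - + length (layer P gs′ h)
    ≡⟨ cong₂ (λ p q → + p - + q) (length-layer P gs h) (length-layer P gs′ h) ⟩
  + (suc h + (truncatedSum h gs + top (sum gs))) - + (suc h + (truncatedSum h gs′ + top (sum gs′)))
    ≡⟨ cong (λ s → + (suc h + (truncatedSum h gs + top s)) - + (suc h + (truncatedSum h gs′ + top (sum gs′)))) sum≡ ⟩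
  + suc h ℤ.+ (+ truncatedSum h gs ℤ.+ c) - (+ suc h ℤ.+ (+ truncatedSum h gs′ ℤ.+ c))
    ≡⟨ cong (λ t → + suc h ℤ.+ (t ℤ.+ c) - (+ suc h ℤ.+ (+ truncatedSum h gs′ ℤ.+ c))) eq ⟩
  + suc h ℤ.+ (z ℤ.+ + truncatedSum h gs′ ℤ.+ c) - (+ suc h ℤ.+ (+ truncatedSum h gs′ ℤ.+ c))
    ≡⟨ cancel (+ suc h) z (+ truncatedSum h gs′) c ⟩
  z ∎
  where
  open ≡-Reasoning
  top : ℕ → ℕ
  top s = suc (h * (P + s + (P + s))) ∸ (P + s)
  c = + top (sum gs′)
  cancel : ∀ a z t c → a ℤ.+ (z ℤ.+ t ℤ.+ c) - (a ℤ.+ (t ℤ.+ c)) ≡ z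
  cancel = ℤ-solve-∀

realizable-positive : ∀ H .{{_ : NonZero H}} M .{{_ : NonZero M}} (m : Fin H → ℤ) →
                      sumℕ (λ i → ∣ m i ∣) ≡ M → Realizable H m M
realizable-positive H M m sum≡M =
  (_∈ map pos (layer P gs 1)) , (_∈ map pos (layer P gs′ 1))
  , (λ x∈ → widen (A.layer₁-within x∈)) , (λ x∈ → widen (B.layer₁-within x∈))
  , (_ , card-map-+ (A.unique 1 (≤H⇒<P (>-nonZero⁻¹ H))) , ≤-trans A.length-layer₁ size≤)
  , (_ , card-map-+ (B.unique 1 (≤H⇒<P (>-nonZero⁻¹ H))) , ≤-trans B.length-layer₁ size≤)
  , λ i → let h = suc (toℕ i) in
    _ , _
    , card-sumset A.sumsetSequence h (A.unique h (≤H⇒<P (toℕ<n i)))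
    , card-sumset B.sumsetSequence h (B.unique h (≤H⇒<P (toℕ<n i)))
    , Excess⇒length-difference P gs gs′ h (sum-uppers≡sum-lowers 0 m) (excess-prescribed 0 m i)
  where
  gs  = uppers 0 m
  gs′ = lowers 0 m
  -- This is the bound of `sum-uppers≤` at start index 0. As `M` is positive it is at least 2 `H`,
  -- so it exceeds every `h` up to `H`.
  P   = 2 * (H * M)

  ≤H⇒<P : ∀ {h} → h ≤ H → h < P
  ≤H⇒<P {h} h≤H = begin
    suc h         ≤⟨ s≤s h≤H ⟩
    1 + H         ≤⟨ +-monoˡ-≤ H (>-nonZero⁻¹ H) ⟩
    H + H         ≡⟨ cong (λ k → H + k) (+-identityʳ H) ⟨
    2 * H         ≤⟨ *-monoʳ-≤ 2 (m≤m*n H M) ⟩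
    2 * (H * M)   ∎
    where open ≤-Reasoning

  sum≤P : sum gs ≤ P
  sum≤P = subst (λ s → sum gs ≤ 2 * (H * s)) sum≡M (sum-uppers≤ 0 m)

  module A = Layer P gs (≤H⇒<P z≤n) sum≤P
  module B = Layer P gs′ (≤H⇒<P z≤n) (subst (_≤ P) (sum-uppers≡sum-lowers 0 m) sum≤P)

  4P≤60HM : 4 * P ≤ 60 * H * M
  4P≤60HM = begin
    4 * (2 * (H * M)) ≡⟨ *-assoc 4 2 (H * M) ⟨
    8 * (H * M)       ≤⟨ *-monoˡ-≤ (H * M) (m≤m+n 8 52) ⟩
    60 * (H * M)      ≡⟨ *-assoc 60 H M ⟨
    60 * H * M        ∎
    where open ≤-Reasoning

  size≤ : 2 + 4 * P ≤ 2 + 60 * H * M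
  size≤ = +-monoʳ-≤ 2 4P≤60HM

  -- The bound 4 `P` is 8 `H` `M`, within 60 `H` `M`, and `H` is at most its square.
  widen : ∀ {x} → [ 0ℤ , + (4 * P) ] x → [ 0ℤ , + (60 * H ^ 2 * M) ] x
  widen (0≤x , x≤) = 0≤x , ℤ.≤-trans x≤ (ℤ.+≤+ (≤-trans 4P≤60HM
    (*-monoˡ-≤ M (*-monoʳ-≤ 60 (m≤m*n H (H * 1) {{m*n≢0 H 1}})))))

realizable : ∀ H .{{_ : NonZero H}} (m : Fin H → ℤ) M → sumℕ (λ i → ∣ m i ∣) ≡ M → Realizable H m M
realizable H m zero    sum≡0 = realizable-zero m λ i →
  ℤ.∣i∣≡0⇒i≡0 (n≤0⇒n≡0 (subst (∣ m i ∣ ≤_) sum≡0 (∣m∣≤sum m i)))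
realizable H m (suc M) sum≡M = realizable-positive H (suc M) m sum≡M

theorem1p2 : (H : ℕ) .{{_ : NonZero H}} (m : Fin H → ℤ) →
    let M = sumℕ (λ i → ∣ m i ∣) in
    ∃[ A ] ∃[ B ]
    A ⊆ [ 0ℤ , + (60 * H ^ 2 * M) ] ×
    B ⊆ [ 0ℤ , + (60 * H ^ 2 * M) ] ×
    (∃[ k ] Card[ A ]≡ k × k ≤ 2 + 60 * H * M) ×
    (∃[ k ] Card[ B ]≡ k × k ≤ 2 + 60 * H * M) ×
    (∀ (i : Fin H) → let h = suc (toℕ i) in
    ∃[ p ] ∃[ q ] Card[ h · A ]≡ p × Card[ h · B ]≡ q × + p - + q ≡ m i)
theorem1p2 H m = realizable H m _ refl
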